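{- For every integer $\Delta\ge4$, one has $A_\Delta=+\infty$, where \[ A_\Delta=\sup\{\tau_D(G)-\mathsf{B}_{\mathrm{HY}}(G): G \text{ is a connected graph with } \Delta(G)=\Delta\}, \] the supremum being taken in the extended reals.
   Context: All graphs are finite, simple and undirected. $\Delta(G)$ denotes the maximum degree of $G$. A set $T\subseteq V(G)$ is an identifying vertex cover if $e\cap T\neq\emptyset$ for every $e\in E(G)$ and the sets $e\cap T$ ($e\in E(G)$) are pairwise distinct; $\tau_D(G)$ is the minimum cardinality of an identifying vertex cover of $G$. For a graph $G$ of order $n$, size $m$ and maximum degree $\Delta$, \[ \mathsf{B}_{\mathrm{HY}}(G)=\frac{\Delta(\Delta-1)n+2m}{\Delta^2+1}. \] -}

module Defs where

open import Data.Bool.Base using (Bool; true; false; T)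
open import Data.Bool.Properties as Bool using (T?)
open import Data.Fin.Base using (Fin)
open import Data.Fin.Properties using (any?) renaming (_<?_ to _<ᶠ?_)
open import Data.Fin.Subset using (Subset; _∈_; ⁅_⁆; _∪_; _∩_; ∣_∣; Nonempty) renaming (⊤ to full)
open import Data.Fin.Subset.Properties
  using (x∈⁅x⁆; x∈p∪q⁺; ∩-identityʳ; anySubset?; nonempty?)
open import Data.Integer.Base using (+_)
open import Data.List.Base using (allFin; cartesianProduct; filter; length; map)
open import Data.List.Extrema.Nat using (max)
open import Data.Nat.Base using (ℕ; _+_; _*_; _∸_; _^_; _≤_; _<_)
open import Data.Nat.Induction using (<-wellFounded)
open import Data.Nat.Properties using (_<?_; ≮⇒≥)
open import Data.Product.Base using (Σ; ∃; ∃₂; _×_; _,_; proj₁; proj₂)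
open import Data.Rational.Base as ℚ using (ℚ)
open import Data.Rational.Properties as ℚ using ()
open import Data.Sum.Base using (inj₁)
open import Data.Unit.Base using (⊤; tt)
open import Data.Vec.Base using (tabulate)
open import Data.Vec.Properties using (≡-dec)
open import Function.Base using (_∘_)
open import Induction.WellFounded using (Acc; acc)
open import Relation.Binary.Construct.Closure.ReflexiveTransitive using (Star)
open import Relation.Binary.PropositionalEquality using (_≡_; refl; sym; trans; subst)
open import Relation.Nullary.Decidable
  using (Dec; yes; no; ¬?; _×-dec_; _→-dec_; map′; decidable-stable)
open import Relation.Unary using (Decidable)

record Graph : Set where
  field
    order  : ℕ
    adj    : Fin order → Fin order → Bool
    adj-sym    : ∀ u v → adj u v ≡ adj v u
    adj-irrefl : ∀ u → adj u u ≡ false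

  Vertex : Set
  Vertex = Fin order

  infix 4 _~_
  _~_ : Vertex → Vertex → Set
  u ~ v = T (adj u v)

  Connected : Set
  Connected = ∀ u v → Star _~_ u v

  degree : Vertex → ℕ
  degree v = ∣ tabulate (adj v) ∣

  -- The graph without vertices gets maximum degree 0.
  maxDegree : ℕ
  maxDegree = max 0 (map degree (allFin order))

  -- Each edge {u , v} is counted once, at its ordered pair u < v.
  size : ℕ
  size = length (filter (λ (u , v) → (u <ᶠ? v) ×-dec T? (adj u v))
                        (cartesianProduct (allFin order) (allFin order)))

  IsEdge : Subset order → Set
  IsEdge e = ∃₂ λ u v → u ~ v × e ≡ ⁅ u ⁆ ∪ ⁅ v ⁆

  record IdentifyingVertexCover (S : Subset order) : Set where
    constructor mkIVC
    field
      covers     : ∀ e → IsEdge e → Nonempty (e ∩ S)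
      identifies : ∀ e → IsEdge e → ∀ f → IsEdge f → e ∩ S ≡ f ∩ S → e ≡ f

IsMinimumIVC : (G : Graph) → Subset (Graph.order G) → Set
IsMinimumIVC G S = IdentifyingVertexCover S ×
                   (∀ S′ → IdentifyingVertexCover S′ → ∣ S ∣ ≤ ∣ S′ ∣)
  where open Graph G

private
  allSubset? : ∀ {n} {P : Subset n → Set} → Decidable P → Dec (∀ S → P S)
  allSubset? P? = map′
    (λ ∄ S → decidable-stable (P? S) (λ ¬p → ∄ (S , ¬p)))
    (λ ∀P (S , ¬p) → ¬p (∀P S))
    (¬? (anySubset? (¬? ∘ P?)))

  minimize : ∀ {n} {P : Subset n → Set} → Decidable P →
             ∀ S → P S → Acc _<_ ∣ S ∣ →
             ∃ λ M → P M × (∀ S′ → P S′ → ∣ M ∣ ≤ ∣ S′ ∣)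
  minimize P? S p (acc rec)
    with anySubset? (λ S′ → P? S′ ×-dec (∣ S′ ∣ <? ∣ S ∣))
  ... | yes (S′ , p′ , lt) = minimize P? S′ p′ (rec lt)
  ... | no ∄               = S , p , λ S′ p′ → ≮⇒≥ (λ lt → ∄ (S′ , p′ , lt))

module _ (G : Graph) where
  open Graph G

  isEdge? : Decidable IsEdge
  isEdge? e = any? λ u → any? λ v →
    T? (adj u v) ×-dec ≡-dec Bool._≟_ e (⁅ u ⁆ ∪ ⁅ v ⁆)

  identifyingVertexCover? : Decidable IdentifyingVertexCover
  identifyingVertexCover? S = map′
    (λ (c , i) → mkIVC c i)
    (λ (mkIVC c i) → c , i)
    (allSubset? (λ e → isEdge? e →-dec nonempty? (e ∩ S))
      ×-dec
     allSubset? (λ e → isEdge? e →-dec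
       allSubset? (λ f → isEdge? f →-dec
         (≡-dec Bool._≟_ (e ∩ S) (f ∩ S) →-dec ≡-dec Bool._≟_ e f))))

  full-identifyingVertexCover : IdentifyingVertexCover full
  full-identifyingVertexCover = mkIVC
    (λ { e (u , v , _ , refl) →
         u , subst (_ ∈_) (sym (∩-identityʳ e))
               (x∈p∪q⁺ (inj₁ (x∈⁅x⁆ u))) })
    (λ e _ f _ eq → trans (sym (∩-identityʳ e)) (trans eq (∩-identityʳ f)))

  minimumIVC : ∃ (IsMinimumIVC G)
  minimumIVC = minimize identifyingVertexCover? full
                 full-identifyingVertexCover (<-wellFounded _)

  τ-D : ℕ
  τ-D = ∣ proj₁ minimumIVC ∣

  B-HY : ℚ
  B-HY = + (Δ * (Δ ∸ 1) * order + 2 * size) ℚ./ (1 + Δ ^ 2)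
    where Δ = maxDegree

-- An extended real x is represented by its open lower cut {q ∈ ℚ ∣ q < x}.
-- Neither inhabitation nor boundedness of the cut is required: the empty cut
-- is -∞ and the cut containing every rational is +∞.
record ℝ̄ : Set₁ where
  field
    Below   : ℚ → Set
    lower   : ∀ {p q} → p ℚ.< q → Below q → Below p
    rounded : ∀ {p} → Below p → ∃ λ q → p ℚ.< q × Below q
open ℝ̄ public

infix 4 _≤ᴿ_ _≈ᴿ_

_≤ᴿ_ : ℝ̄ → ℝ̄ → Set
x ≤ᴿ y = ∀ q → Below x q → Below y q

_≈ᴿ_ : ℝ̄ → ℝ̄ → Set
x ≈ᴿ y = x ≤ᴿ y × y ≤ᴿ x

fromℚ : ℚ → ℝ̄
fromℚ x = record
  { Below   = ℚ._< x
  ; lower   = ℚ.<-trans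
  ; rounded = ℚ.<-dense
  }

+∞ : ℝ̄
+∞ = record
  { Below   = λ _ → ⊤
  ; lower   = λ _ _ → tt
  ; rounded = λ {p} _ → p ℚ.+ ℚ.1ℚ , p<p+1 p , tt
  }
  where
  p<p+1 : ∀ p → p ℚ.< p ℚ.+ ℚ.1ℚ
  p<p+1 p = subst (ℚ._< p ℚ.+ ℚ.1ℚ) (ℚ.+-identityʳ p)
              (ℚ.+-monoʳ-< p (ℚ.positive⁻¹ ℚ.1ℚ))

sup : {I : Set} → (I → ℝ̄) → ℝ̄
sup x = record
  { Below   = λ q → ∃ λ i → Below (x i) q
  ; lower   = λ p<q (i , b) → i , lower (x i) p<q b
  ; rounded = λ (i , b) → let (q , p<q , b′) = rounded (x i) b in q , p<q , i , b′
  }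

sup-upper : ∀ {I : Set} (x : I → ℝ̄) i → x i ≤ᴿ sup x
sup-upper x i q b = i , b

sup-least : ∀ {I : Set} (x : I → ℝ̄) y → (∀ i → x i ≤ᴿ y) → sup x ≤ᴿ y
sup-least x y x≤y q (i , b) = x≤y i q b

fromℚ-mono : ∀ {p q} → p ℚ.≤ q → fromℚ p ≤ᴿ fromℚ q
fromℚ-mono p≤q r r<p = ℚ.<-≤-trans r<p p≤q

A : ℕ → ℝ̄
A Δ = sup {I = Σ Graph λ G → Graph.Connected G × Graph.maxDegree G ≡ Δ}
          (λ (G , _) → fromℚ (+ τ-D G ℚ./ 1 ℚ.- B-HY G))

{-# OPTIONS --safe #-}

-- The complement of an identifying vertex cover is a set of vertices at pairwise distance at least 3.
-- In a graph H of diameter 2 it has at most one element, so in k copies of H joined into a path by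
-- k − 1 edges it has at most k, and every identifying vertex cover has size at least k (n − 1), where
-- n is the order of H.  Hence τ_D − B_HY grows linearly in k as soon as
-- n (Δ + 1) − 2 m > Δ² + 3, where m is the size of H.  For H take the Petersen graph with the four
-- vertices of a maximum independent set replaced by s twins each: it has 6 vertices of degree 2s + 1
-- and 4s of degree 3, and the inequality holds for Δ = 2s + 2 and Δ = 2s + 3 with s ≥ 1.
module Submission where

open import Defs
open import Data.Bool.Base using (Bool; true; false; T; not; _∧_; _∨_; if_then_else_)
open import Data.Bool.Properties as Bool using (T?; T-∧; T-∨; T-≡; ∨-comm)
open import Data.Fin.Base
  using (Fin; zero; suc; toℕ; combine; remQuot; remainder; splitAt; join; inject₁; _↑ˡ_; _↑ʳ_)
open import Data.Fin.Patterns
open import Data.Fin.Properties as Fin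
  using (_≟_; _<?_; <-cmp; all?; any?; remQuot-combine; combine-remQuot)
open import Data.Fin.Subset using (Subset; _∈_; _∉_; ⁅_⁆; _∪_; _∩_; ∣_∣; Empty)
open import Data.Fin.Subset.Properties
  using (x∈⁅x⁆; x∈⁅y⁆⇒x≡y; x∈p∪q⁺; x∈p∪q⁻; x∈p∩q⁻; ∩-distribʳ-∪; ∪-identityʳ; Empty-unique)
import Data.Integer.Base as ℤ
import Data.Integer.Properties as ℤ
open import Data.List.Base using (_++_; allFin; cartesianProduct; filter; length; map; tabulate)
open import Data.List.Extrema.Nat using (max≤v⁺; v≤max⁺)
open import Data.List.Membership.Propositional.Properties using (∈-allFin)
open import Data.List.Properties using (filter-++; length-++)
import Data.List.Relation.Unary.All.Properties as All
import Data.List.Relation.Unary.Any as Any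
import Data.List.Relation.Unary.Any.Properties as Any
open import Data.Nat.Base using (ℕ; zero; suc; _+_; _*_; _∸_; _^_; _≤_; z≤n; s≤s; _≡ᵇ_)
open import Data.Nat.Properties as ℕ hiding (_≟_; _<?_; <-cmp)
open import Algebra.Properties.Semiring.Sum +-*-semiring
open import Data.Nat.Tactic.RingSolver using (solve-∀)
open import Data.Product.Base using (∃; _×_; _,_; proj₁; proj₂; uncurry)
import Data.Rational.Base as ℚ
import Data.Rational.Properties as ℚ
open import Data.Rational.Unnormalised.Base as ℚᵘ using (mkℚᵘ; *≤*; *<*)
import Data.Rational.Unnormalised.Properties as ℚᵘ
open import Data.Sum.Base as Sum using (_⊎_; inj₁; inj₂)
import Data.Vec.Base as Vec
open import Data.Vec.Functional using (Vector)
open import Data.Vec.Properties using (tabulate∘lookup; []=⇒lookup)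
open import Function.Base using (_∘_)
open import Function.Bundles using (Equivalence)
open import Relation.Binary.Construct.Closure.ReflexiveTransitive using (Star; ε; _◅_; _◅◅_; reverse)
open import Relation.Binary.Definitions using (tri<; tri≈; tri>)
open import Relation.Binary.PropositionalEquality
open import Relation.Nullary.Decidable using (does; yes; no; _×-dec_; _⊎-dec_; dec-true; dec-false; from-yes)
open import Relation.Nullary.Negation using (¬_; contradiction)
open import Relation.Unary using (Decidable)

-- Finite sums of natural numbers and counting.

𝟙 : Bool → ℕ
𝟙 b = if b then 1 else 0

𝟙-∧ : ∀ a b → 𝟙 (a ∧ b) ≡ 𝟙 a * 𝟙 b
𝟙-∧ true  b = sym (+-identityʳ (𝟙 b))
𝟙-∧ false b = refl

∑-const : ∀ n c → ∑[ i < n ] c ≡ n * c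
∑-const zero    c = refl
∑-const (suc n) c = cong (c +_) (∑-const n c)

∑-mono : ∀ {n} {f g : Vector ℕ n} → (∀ i → f i ≤ g i) → sum f ≤ sum g
∑-mono {zero}  f≤g = z≤n
∑-mono {suc n} f≤g = +-mono-≤ (f≤g zero) (∑-mono (f≤g ∘ suc))

∑-split : ∀ m {n} (f : Vector ℕ (m + n)) →
          sum f ≡ ∑[ i < m ] f (i ↑ˡ n) + ∑[ j < n ] f (m ↑ʳ j)
∑-split zero    f = refl
∑-split (suc m) f = trans (cong (f zero +_) (∑-split m (f ∘ suc))) (sym (+-assoc (f zero) _ _))

∑-combine : ∀ m n (f : Vector ℕ (m * n)) → sum f ≡ ∑[ i < m ] ∑[ j < n ] f (combine i j)
∑-combine zero    n f = refl
∑-combine (suc m) n f = trans (∑-split n f)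
  (cong (∑[ j < n ] f (j ↑ˡ m * n) +_) (∑-combine m n (f ∘ (n ↑ʳ_))))

∑-remQuot : ∀ m n (f : Fin m × Fin n → ℕ) →
            ∑[ x < m * n ] f (remQuot n x) ≡ ∑[ i < m ] ∑[ j < n ] f (i , j)
∑-remQuot m n f = trans (∑-combine m n (f ∘ remQuot n))
  (sum-cong-≗ λ i → sum-cong-≗ λ j → cong f (remQuot-combine i j))

∑-product : ∀ {m n} (f : Vector ℕ m) (g : Vector ℕ n) →
            ∑[ i < m ] ∑[ j < n ] (f i * g j) ≡ sum f * sum g
∑-product f g = trans (sum-cong-≗ λ i → sym (*-distribˡ-sum (f i) g)) (sym (*-distribʳ-sum (sum g) f))

-- Bounds both the number of links leaving or entering a copy and the number of vertices of a copy
-- that a cover misses.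
∑-atMostOne : ∀ {n} (b : Fin n → Bool) → (∀ i j → T (b i) → T (b j) → i ≡ j) →
              ∑[ i < n ] 𝟙 (b i) ≤ 1
∑-atMostOne {zero}  b unique = z≤n
∑-atMostOne {suc n} b unique with b zero in b₀
... | false = ∑-atMostOne (b ∘ suc) λ i j bi bj → Fin.suc-injective (unique (suc i) (suc j) bi bj)
... | true  = s≤s (≤-trans (∑-mono rest) (≤-reflexive (sum-replicate-zero n)))
  where
  rest : ∀ i → 𝟙 (b (suc i)) ≤ 0
  rest i with b (suc i) in bᵢ
  ... | false = z≤n
  ... | true  with () ← unique zero (suc i) (Equivalence.from T-≡ b₀) (Equivalence.from T-≡ bᵢ)

∑-δ : ∀ {n} (p : Fin n) → ∑[ i < n ] 𝟙 (does (p ≟ i)) ≡ 1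
∑-δ {suc n} zero    = cong suc (sum-replicate-zero n)
∑-δ {suc n} (suc p) = ∑-δ p

∣tabulate∣ : ∀ {n} (b : Fin n → Bool) → ∣ Vec.tabulate b ∣ ≡ ∑[ i < n ] 𝟙 (b i)
∣tabulate∣ {zero}  b = refl
∣tabulate∣ {suc n} b with b zero
... | true  = cong suc (∣tabulate∣ (b ∘ suc))
... | false = ∣tabulate∣ (b ∘ suc)

∑-lookup : ∀ {n} (S : Subset n) → ∑[ x < n ] 𝟙 (Vec.lookup S x) ≡ ∣ S ∣
∑-lookup S = trans (sym (∣tabulate∣ (Vec.lookup S))) (cong ∣_∣ (tabulate∘lookup S))

length-filter-map-tabulate : ∀ {A B : Set} {P : B → Set} (P? : Decidable P) (g : A → B) {n} (f : Fin n → A) →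
  length (filter P? (map g (tabulate f))) ≡ ∑[ i < n ] 𝟙 (does (P? (g (f i))))
length-filter-map-tabulate P? g {zero}  f = refl
length-filter-map-tabulate P? g {suc n} f with does (P? (g (f zero)))
... | true  = cong suc (length-filter-map-tabulate P? g (f ∘ suc))
... | false = length-filter-map-tabulate P? g (f ∘ suc)

-- Turns the list-based `size` into a double sum, which can be compared with the sum of the degrees.
length-filter-cartesianProduct : ∀ {A B : Set} {P : A × B → Set} (P? : Decidable P)
  {m n} (f : Fin m → A) (g : Fin n → B) →
  length (filter P? (cartesianProduct (tabulate f) (tabulate g))) ≡
  ∑[ i < m ] ∑[ j < n ] 𝟙 (does (P? (f i , g j)))
length-filter-cartesianProduct P? {zero}  f g = refl
length-filter-cartesianProduct P? {suc m} f g = begin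
  length (filter P? (row ++ rest))                  ≡⟨ cong length (filter-++ P? row rest) ⟩
  length (filter P? row ++ filter P? rest)          ≡⟨ length-++ (filter P? row) ⟩
  length (filter P? row) + length (filter P? rest)  ≡⟨ cong₂ _+_ (length-filter-map-tabulate P? (f zero ,_) g)
                                                                 (length-filter-cartesianProduct P? (f ∘ suc) g) ⟩
  _                                                 ∎
  where
  open ≡-Reasoning
  row  = map (f zero ,_) (tabulate g)
  rest = cartesianProduct (tabulate (f ∘ suc)) (tabulate g)

-- Degrees and identifying vertex covers of a single graph.

module _ (G : Graph) where
  open Graph G

  degree≡∑ : ∀ v → degree v ≡ ∑[ u < order ] 𝟙 (adj v u)
  degree≡∑ v = ∣tabulate∣ (adj v)

  -- Each adjacent ordered pair is either increasing or decreasing. Exchanging the sums shows that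
  -- both kinds are counted by `size`.
  handshake : 2 * size ≡ ∑[ v < order ] degree v
  handshake = sym (begin
    ∑[ u < order ] degree u
      ≡⟨ sum-cong-≗ degree≡∑ ⟩
    ∑[ u < order ] ∑[ v < order ] 𝟙 (adj u v)
      ≡⟨ sum-cong-≗ (λ u → sum-cong-≗ (orient u)) ⟩
    ∑[ u < order ] ∑[ v < order ] (up u v + up v u)
      ≡⟨ sum-cong-≗ (λ u → ∑-distrib-+ (up u) (λ v → up v u)) ⟩
    ∑[ u < order ] (∑[ v < order ] up u v + ∑[ v < order ] up v u)
      ≡⟨ ∑-distrib-+ (λ u → ∑[ v < order ] up u v) (λ u → ∑[ v < order ] up v u) ⟩
    ∑[ u < order ] ∑[ v < order ] up u v + ∑[ u < order ] ∑[ v < order ] up v u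
      ≡⟨ cong (∑[ u < order ] ∑[ v < order ] up u v +_) (∑-comm (λ u v → up v u)) ⟩
    ∑[ u < order ] ∑[ v < order ] up u v + ∑[ u < order ] ∑[ v < order ] up u v
      ≡⟨ cong₂ _+_ size≡ (trans size≡ (sym (+-identityʳ size))) ⟩
    2 * size ∎)
    where
    open ≡-Reasoning
    up : Vertex → Vertex → ℕ
    up u v = 𝟙 (does ((u <? v) ×-dec T? (adj u v)))
    size≡ : ∑[ u < order ] ∑[ v < order ] up u v ≡ size
    size≡ = sym (length-filter-cartesianProduct (λ (u , v) → (u <? v) ×-dec T? (adj u v)) (λ u → u) λ v → v)
    up-< : ∀ {u v} → does (u <? v) ≡ true → up u v ≡ 𝟙 (adj u v)
    up-< eq rewrite eq = refl
    up-≮ : ∀ {u v} → does (u <? v) ≡ false → up u v ≡ 0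
    up-≮ eq rewrite eq = refl
    orient : ∀ u v → 𝟙 (adj u v) ≡ up u v + up v u
    orient u v with <-cmp u v
    ... | tri< u<v _ v≮u = sym (trans
      (cong₂ _+_ (up-< (dec-true (u <? v) u<v)) (up-≮ {v} {u} (dec-false (v <? u) v≮u)))
      (+-identityʳ (𝟙 (adj u v))))
    ... | tri> u≮v _ v<u = sym (trans
      (cong₂ _+_ (up-≮ {u} {v} (dec-false (u <? v) u≮v)) (up-< (dec-true (v <? u) v<u)))
      (cong 𝟙 (adj-sym v u)))
    ... | tri≈ u≮u refl _ = trans (cong 𝟙 (adj-irrefl u)) (sym (cong₂ _+_ up≡0 up≡0))
      where
      up≡0 : up u u ≡ 0
      up≡0 = up-≮ {u} {u} (dec-false (u <? u) u≮u)

  maxDegree≡ : ∀ {d} → (∀ v → degree v ≤ d) → ∀ v → degree v ≡ d → maxDegree ≡ d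
  maxDegree≡ {d} degree≤d v degree≡d = ≤-antisym
    (max≤v⁺ {xs = map degree (allFin order)} z≤n (All.map⁺ (All.tabulate⁺ degree≤d)))
    (v≤max⁺ 0 (map degree (allFin order))
      (inj₂ (Any.map⁺ (Any.map (λ { refl → ≤-reflexive (sym degree≡d) }) (∈-allFin v)))))

  -- Distance at most 2, except that Close u u requires u to have a neighbour.
  Close : Vertex → Vertex → Set
  Close u v = u ~ v ⊎ ∃ λ w → w ~ u × w ~ v

  ~-sym : ∀ {u v} → u ~ v → v ~ u
  ~-sym {u} {v} = subst T (adj-sym u v)

  ~-irrefl : ∀ {u} → ¬ u ~ u
  ~-irrefl {u} rewrite adj-irrefl u = λ ()

  module _ {S : Subset order} (ivc : IdentifyingVertexCover S) where
    open IdentifyingVertexCover ivc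

    -- A vertex outside `S` contributes nothing to the trace of its edge, so only the other end is
    -- visible.
    trace-∉ : ∀ w {u} → u ∉ S → (⁅ w ⁆ ∪ ⁅ u ⁆) ∩ S ≡ ⁅ w ⁆ ∩ S
    trace-∉ w {u} u∉S = trans (∩-distribʳ-∪ S ⁅ w ⁆ ⁅ u ⁆)
      (trans (cong (⁅ w ⁆ ∩ S ∪_) (Empty-unique empty)) (∪-identityʳ (⁅ w ⁆ ∩ S)))
      where
      empty : Empty (⁅ u ⁆ ∩ S)
      empty (x , x∈) with x∈p∩q⁻ ⁅ u ⁆ S x∈
      ... | x∈u , x∈S with refl ← x∈⁅y⁆⇒x≡y u x∈u = u∉S x∈S

    -- If two vertices outside `S` are adjacent, their edge is not covered. If they have a common
    -- neighbour `w`, both edges at `w` leave the same trace, so they are the same edge.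
    uncovered-unique : ∀ {u v} → u ∉ S → v ∉ S → Close u v → u ≡ v
    uncovered-unique {u} {v} u∉S v∉S (inj₁ u~v)
      with x , x∈ ← covers (⁅ u ⁆ ∪ ⁅ v ⁆) (u , v , u~v , refl)
      with x∈e , x∈S ← x∈p∩q⁻ (⁅ u ⁆ ∪ ⁅ v ⁆) S x∈
      with x∈p∪q⁻ ⁅ u ⁆ ⁅ v ⁆ x∈e
    ... | inj₁ x∈u with refl ← x∈⁅y⁆⇒x≡y u x∈u = contradiction x∈S u∉S
    ... | inj₂ x∈v with refl ← x∈⁅y⁆⇒x≡y v x∈v = contradiction x∈S v∉S
    uncovered-unique {u} {v} u∉S v∉S (inj₂ (w , w~u , w~v))
      with x∈p∪q⁻ ⁅ w ⁆ ⁅ v ⁆ (subst (u ∈_) same (x∈p∪q⁺ (inj₂ (x∈⁅x⁆ u))))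
      where
      same : ⁅ w ⁆ ∪ ⁅ u ⁆ ≡ ⁅ w ⁆ ∪ ⁅ v ⁆
      same = identifies _ (w , u , w~u , refl) _ (w , v , w~v , refl)
               (trans (trace-∉ w u∉S) (sym (trace-∉ w v∉S)))
    -- Equality of the two edges puts `u` at `w` or at `v`; the former would make `w` adjacent to
    -- itself.
    ... | inj₁ u∈w with refl ← x∈⁅y⁆⇒x≡y w u∈w = contradiction w~u ~-irrefl
    ... | inj₂ u∈v = x∈⁅y⁆⇒x≡y v u∈v

-- Copies of a graph joined into a chain.

module Chain (G : Graph) (p q : Graph.Vertex G) (k : ℕ) where
  open Graph G

  -- A Boolean test on the underlying numbers, so that the sums over successors and predecessors of
  -- a concrete copy reduce by computation.
  next : Fin k → Fin k → Bool
  next i j = toℕ j ≡ᵇ suc (toℕ i)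

  next-irrefl : ∀ i → next i i ≡ false
  next-irrefl i = ≡ᵇ-suc (toℕ i)
    where
    ≡ᵇ-suc : ∀ n → (n ≡ᵇ suc n) ≡ false
    ≡ᵇ-suc zero    = refl
    ≡ᵇ-suc (suc n) = ≡ᵇ-suc n

  next-asym : ∀ i j → T (next i j) → next j i ≡ false
  next-asym i j = ≡ᵇ-asym (toℕ i) (toℕ j)
    where
    ≡ᵇ-asym : ∀ m n → T (n ≡ᵇ suc m) → (m ≡ᵇ suc n) ≡ false
    ≡ᵇ-asym zero    n       _ = refl
    ≡ᵇ-asym (suc m) (suc n) t = ≡ᵇ-asym m n t

  next-unique : ∀ i j l → T (next i j) → T (next i l) → j ≡ l
  next-unique i j l t u = Fin.toℕ-injective (trans (≡ᵇ⇒≡ _ _ t) (sym (≡ᵇ⇒≡ _ _ u)))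

  next-unique⁻¹ : ∀ i j l → T (next j i) → T (next l i) → j ≡ l
  next-unique⁻¹ i j l t u = Fin.toℕ-injective
    (suc-injective (trans (sym (≡ᵇ⇒≡ (toℕ i) _ t)) (≡ᵇ⇒≡ (toℕ i) _ u)))

  -- The ends `p` and `q` may coincide; vertex `p` of an interior copy then gains two neighbours
  -- instead of one.
  inside link : Fin k × Vertex → Fin k × Vertex → Bool
  inside (i , u) (j , v) = does (i ≟ j) ∧ adj u v
  link   (i , u) (j , v) = (does (p ≟ u) ∧ next i j) ∧ does (q ≟ v)

  adj₂ : Fin k × Vertex → Fin k × Vertex → Bool
  adj₂ x y = inside x y ∨ (link x y ∨ link y x)

  adj₂-sym : ∀ x y → adj₂ x y ≡ adj₂ y x
  adj₂-sym x@(i , u) y@(j , v) = cong₂ _∨_ inside-sym (∨-comm (link x y) (link y x))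
    where
    inside-sym : inside x y ≡ inside y x
    inside-sym with i ≟ j | j ≟ i
    ... | yes _   | yes _   = adj-sym u v
    ... | no _    | no _    = refl
    ... | yes i≡j | no j≢i  = contradiction (sym i≡j) j≢i
    ... | no i≢j  | yes j≡i = contradiction (sym j≡i) i≢j

  adj₂-irrefl : ∀ x → adj₂ x x ≡ false
  adj₂-irrefl (i , u)
    rewrite dec-true (i ≟ i) refl | adj-irrefl u | next-irrefl i with does (p ≟ u)
  ... | true  = refl
  ... | false = refl

  chain : Graph
  chain = record
    { order      = k * order
    ; adj        = λ x y → adj₂ (remQuot order x) (remQuot order y)
    ; adj-sym    = λ x y → adj₂-sym (remQuot order x) (remQuot order y)
    ; adj-irrefl = λ x → adj₂-irrefl (remQuot order x)
    }

  -- The three kinds of adjacency exclude each other, so the disjunction becomes a sum. In each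
  -- summand the dependence on `j` is separated from that on `v`, so the double sum giving the
  -- degree factorises.
  𝟙-adj₂ : ∀ i u j v → 𝟙 (adj₂ (i , u) (j , v)) ≡
    𝟙 (does (i ≟ j)) * 𝟙 (adj u v)
      + ((𝟙 (does (p ≟ u)) * 𝟙 (next i j)) * 𝟙 (does (q ≟ v))
      + (𝟙 (does (q ≟ u)) * 𝟙 (next j i)) * 𝟙 (does (p ≟ v)))
  𝟙-adj₂ i u j v = begin
    𝟙 (inside x y ∨ (link x y ∨ link y x))
      ≡⟨ 𝟙-∨ (inside x y) _ (λ t → cong₂ _∨_ (inside⇒ t) (inside⇒′ t)) ⟩
    𝟙 (inside x y) + 𝟙 (link x y ∨ link y x)
      ≡⟨ cong (𝟙 (inside x y) +_) (𝟙-∨ (link x y) (link y x) link-asym) ⟩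
    𝟙 (inside x y) + (𝟙 (link x y) + 𝟙 (link y x))
      ≡⟨ cong₂ _+_ (𝟙-∧ (does (i ≟ j)) (adj u v))
           (cong₂ _+_ (𝟙-link i u j v) (trans (𝟙-link j v i u) (swap (𝟙 (does (p ≟ v))) _ _))) ⟩
    _ ∎
    where
    open ≡-Reasoning
    x = i , u
    y = j , v
    swap : ∀ a b c → (a * b) * c ≡ (c * b) * a
    swap = solve-∀
    𝟙-∨ : ∀ a b → (T a → b ≡ false) → 𝟙 (a ∨ b) ≡ 𝟙 a + 𝟙 b
    𝟙-∨ true  b excl = cong (λ b → 1 + 𝟙 b) (sym (excl _))
    𝟙-∨ false b excl = refl
    𝟙-link : ∀ i u j v → 𝟙 (link (i , u) (j , v)) ≡ (𝟙 (does (p ≟ u)) * 𝟙 (next i j)) * 𝟙 (does (q ≟ v))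
    𝟙-link i u j v = trans (𝟙-∧ (does (p ≟ u) ∧ next i j) (does (q ≟ v)))
      (cong (_* 𝟙 (does (q ≟ v))) (𝟙-∧ (does (p ≟ u)) (next i j)))
    link-false : ∀ i u j v → next i j ≡ false → link (i , u) (j , v) ≡ false
    link-false i u j v eq rewrite eq with does (p ≟ u)
    ... | true  = refl
    ... | false = refl
    -- Adjacency inside a copy forces equal copy indices, and no copy is its own successor.
    inside⇒ : T (inside x y) → link x y ≡ false
    inside⇒ t with yes refl ← i ≟ j = link-false i u i v (next-irrefl i)
    inside⇒′ : T (inside x y) → link y x ≡ false
    inside⇒′ t with yes refl ← i ≟ j = link-false i v i u (next-irrefl i)
    link-asym : T (link x y) → link y x ≡ false
    link-asym t = link-false j v i u (next-asym i j
      (proj₂ (Equivalence.to (T-∧ {does (p ≟ u)}) (proj₁ (Equivalence.to (T-∧ {_} {does (q ≟ v)}) t)))))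

  succs preds : Fin k → ℕ
  succs i = ∑[ j < k ] 𝟙 (next i j)
  preds i = ∑[ j < k ] 𝟙 (next j i)

  degree₂ : Fin k × Vertex → ℕ
  degree₂ (i , u) = degree u + (𝟙 (does (p ≟ u)) * succs i + 𝟙 (does (q ≟ u)) * preds i)

  degree-chain : ∀ x → Graph.degree chain x ≡ degree₂ (remQuot order x)
  degree-chain x = begin
    Graph.degree chain x
      ≡⟨ degree≡∑ chain x ⟩
    ∑[ y < k * order ] 𝟙 (adj₂ (i , u) (remQuot order y))
      ≡⟨ ∑-remQuot k order (λ y → 𝟙 (adj₂ (i , u) y)) ⟩
    ∑[ j < k ] ∑[ v < order ] 𝟙 (adj₂ (i , u) (j , v))
      ≡⟨ sum-cong-≗ (λ j → sum-cong-≗ (𝟙-adj₂ i u j)) ⟩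
    ∑[ j < k ] ∑[ v < order ] (a j * b v + (c j * d v + e j * f v))
      ≡⟨ ∑∑-distrib-+ (λ j v → a j * b v) (λ j v → c j * d v + e j * f v) ⟩
    ∑[ j < k ] ∑[ v < order ] (a j * b v) + ∑[ j < k ] ∑[ v < order ] (c j * d v + e j * f v)
      ≡⟨ cong (∑[ j < k ] ∑[ v < order ] (a j * b v) +_) (∑∑-distrib-+ (λ j v → c j * d v) (λ j v → e j * f v)) ⟩
    ∑[ j < k ] ∑[ v < order ] (a j * b v) +
      (∑[ j < k ] ∑[ v < order ] (c j * d v) + ∑[ j < k ] ∑[ v < order ] (e j * f v))
      ≡⟨ cong₂ _+_ (∑-product a b) (cong₂ _+_ (∑-product c d) (∑-product e f)) ⟩
    sum a * sum b + (sum c * sum d + sum e * sum f)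
      ≡⟨ cong₂ _+_ (cong₂ _*_ (∑-δ i) (sym (degree≡∑ G u)))
           (cong₂ _+_ (cong₂ _*_ (sym (*-distribˡ-sum (𝟙 (does (p ≟ u))) (λ j → 𝟙 (next i j)))) (∑-δ q))
                      (cong₂ _*_ (sym (*-distribˡ-sum (𝟙 (does (q ≟ u))) (λ j → 𝟙 (next j i)))) (∑-δ p))) ⟩
    1 * degree u + ((𝟙 (does (p ≟ u)) * succs i) * 1 + (𝟙 (does (q ≟ u)) * preds i) * 1)
      ≡⟨ cong₂ _+_ (*-identityˡ (degree u))
           (cong₂ _+_ (*-identityʳ (𝟙 (does (p ≟ u)) * succs i)) (*-identityʳ (𝟙 (does (q ≟ u)) * preds i))) ⟩
    degree₂ (i , u) ∎
    where
    open ≡-Reasoning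
    i = proj₁ (remQuot {k} order x)
    u = proj₂ (remQuot {k} order x)
    a c e : Vector ℕ k
    a j = 𝟙 (does (i ≟ j))
    c j = 𝟙 (does (p ≟ u)) * 𝟙 (next i j)
    e j = 𝟙 (does (q ≟ u)) * 𝟙 (next j i)
    b d f : Vector ℕ order
    b v = 𝟙 (adj u v)
    d v = 𝟙 (does (q ≟ v))
    f v = 𝟙 (does (p ≟ v))
    ∑∑-distrib-+ : ∀ (f g : Fin k → Vertex → ℕ) →
      ∑[ j < k ] ∑[ v < order ] (f j v + g j v) ≡
      ∑[ j < k ] ∑[ v < order ] f j v + ∑[ j < k ] ∑[ v < order ] g j v
    ∑∑-distrib-+ f g = trans (sum-cong-≗ λ j → ∑-distrib-+ (f j) (g j))
      (∑-distrib-+ (λ j → ∑[ v < order ] f j v) (λ j → ∑[ v < order ] g j v))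

  -- A copy has at most one successor and one predecessor, so each of the ends `p` and `q` adds at
  -- most one to a degree.
  degree₂≤ : ∀ i u → degree₂ (i , u) ≤ degree u + (𝟙 (does (p ≟ u)) + 𝟙 (does (q ≟ u)))
  degree₂≤ i u = +-monoʳ-≤ (degree u) (+-mono-≤
    (*≤1 (𝟙 (does (p ≟ u))) (∑-atMostOne (next i) (next-unique i)))
    (*≤1 (𝟙 (does (q ≟ u))) (∑-atMostOne (λ j → next j i) (next-unique⁻¹ i))))
    where
    *≤1 : ∀ a {b} → b ≤ 1 → a * b ≤ a
    *≤1 a b≤1 = ≤-trans (*-monoʳ-≤ a b≤1) (≤-reflexive (*-identityʳ a))

  -- Each copy is charged two link ends, although the first and the last copy carry fewer; this
  -- makes the bound linear in `k`.
  size-chain : 2 * Graph.size chain ≤ k * (2 * size + 2)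
  size-chain = begin
    2 * Graph.size chain
      ≡⟨ handshake chain ⟩
    ∑[ x < k * order ] Graph.degree chain x
      ≡⟨ sum-cong-≗ degree-chain ⟩
    ∑[ x < k * order ] degree₂ (remQuot order x)
      ≡⟨ ∑-remQuot k order degree₂ ⟩
    ∑[ i < k ] ∑[ u < order ] degree₂ (i , u)
      ≤⟨ ∑-mono (λ i → ∑-mono (degree₂≤ i)) ⟩
    ∑[ i < k ] ∑[ u < order ] (degree u + (𝟙 (does (p ≟ u)) + 𝟙 (does (q ≟ u))))
      ≡⟨ ∑-const k _ ⟩
    k * ∑[ u < order ] (degree u + (𝟙 (does (p ≟ u)) + 𝟙 (does (q ≟ u))))
      ≡⟨ cong (k *_) (begin-equality
           ∑[ u < order ] (degree u + (𝟙 (does (p ≟ u)) + 𝟙 (does (q ≟ u))))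
             ≡⟨ ∑-distrib-+ degree _ ⟩
           sum degree + ∑[ u < order ] (𝟙 (does (p ≟ u)) + 𝟙 (does (q ≟ u)))
             ≡⟨ cong (sum degree +_) (∑-distrib-+ (λ u → 𝟙 (does (p ≟ u))) _) ⟩
           sum degree + (∑[ u < order ] 𝟙 (does (p ≟ u)) + ∑[ u < order ] 𝟙 (does (q ≟ u)))
             ≡⟨ cong₂ _+_ (sym (handshake G)) (cong₂ _+_ (∑-δ p) (∑-δ q)) ⟩
           2 * size + 2 ∎) ⟩
    k * (2 * size + 2) ∎
    where open ≤-Reasoning

  infix 4 _~ᶜ_
  _~ᶜ_ : Graph.Vertex chain → Graph.Vertex chain → Set
  _~ᶜ_ = Graph._~_ chain

  at : Fin k → Vertex → Graph.Vertex chain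
  at = combine

  adj₂⇒~ : ∀ i u j v → T (adj₂ (i , u) (j , v)) → at i u ~ᶜ at j v
  adj₂⇒~ i u j v = subst T (sym (cong₂ adj₂ (remQuot-combine i u) (remQuot-combine j v)))

  ~-inside : ∀ i {u v} → u ~ v → at i u ~ᶜ at i v
  ~-inside i {u} {v} u~v = adj₂⇒~ i u i v (Equivalence.from T-∨ (inj₁ inside-i))
    where
    inside-i : T (inside (i , u) (i , v))
    inside-i rewrite dec-true (i ≟ i) refl = u~v

  ~-link : ∀ i j → toℕ j ≡ suc (toℕ i) → at i p ~ᶜ at j q
  ~-link i j eq = adj₂⇒~ i p j q
    (Equivalence.from (T-∨ {inside (i , p) (j , q)}) (inj₂ (Equivalence.from T-∨ (inj₁ link-ij))))
    where
    link-ij : T (link (i , p) (j , q))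
    link-ij rewrite dec-true (p ≟ p) refl | dec-true (q ≟ q) refl =
      Equivalence.from T-∧ (≡⇒≡ᵇ (toℕ j) _ eq , _)

  module _ (close : ∀ u v → Close G u v) where

    close-chain : ∀ i u v → Close chain (at i u) (at i v)
    close-chain i u v with close u v
    ... | inj₁ u~v = inj₁ (~-inside i u~v)
    ... | inj₂ (w , w~u , w~v) = inj₂ (at i w , ~-inside i w~u , ~-inside i w~v)

    close⇒Star : ∀ {x y} → Close chain x y → Star _~ᶜ_ x y
    close⇒Star (inj₁ x~y)             = x~y ◅ ε
    close⇒Star (inj₂ (w , w~x , w~y)) = ~-sym chain {w} w~x ◅ w~y ◅ ε

    -- Induction on the number `n` of copies by which `i` lies after `j`, walking back one copy at a
    -- time.
    reach : ∀ n i j → toℕ i ≡ toℕ j + n → ∀ u v → Star _~ᶜ_ (at i u) (at j v)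
    reach zero    i j eq u v with refl ← Fin.toℕ-injective (trans eq (+-identityʳ (toℕ j))) =
      close⇒Star (close-chain i u v)
    reach (suc n) zero j eq u v = contradiction (trans eq (+-suc (toℕ j) n)) 0≢1+n
    reach (suc n) i@(suc i⁻) j eq u v =
      -- Inside copy `i` the walk goes to `q`, from there along the link to `p` in the preceding
      -- copy, and the induction continues.
      close⇒Star (close-chain i u q) ◅◅
      ~-sym chain {at (inject₁ i⁻) p} (~-link (inject₁ i⁻) i (cong suc (sym (Fin.toℕ-inject₁ i⁻)))) ◅
      reach n (inject₁ i⁻) j (trans (Fin.toℕ-inject₁ i⁻) (suc-injective (trans eq (+-suc (toℕ j) n)))) p v

    chain-connected : Graph.Connected chain
    chain-connected x y = subst₂ (Star _~ᶜ_) (combine-remQuot {k} order x) (combine-remQuot {k} order y)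
      (connect (remQuot {k} order x) (remQuot {k} order y))
      where
      connect : ∀ x y → Star _~ᶜ_ (uncurry at x) (uncurry at y)
      connect (i , u) (j , v) with ≤-total (toℕ j) (toℕ i)
      ... | inj₁ j≤i = reach _ i j (sym (m+[n∸m]≡n j≤i)) u v
      ... | inj₂ i≤j = reverse (λ {x} → ~-sym chain {x}) (reach _ j i (sym (m+[n∸m]≡n i≤j)) v u)

    -- Any two vertices of a copy are close, so at most one vertex of each of the `k` copies lies
    -- outside `S`.
    order≤∣S∣+k : ∀ {S} → Graph.IdentifyingVertexCover chain S → k * order ≤ ∣ S ∣ + k
    order≤∣S∣+k {S} ivc = begin
      k * order
        ≡⟨ *-identityʳ (k * order) ⟨
      k * order * 1
        ≡⟨ ∑-const (k * order) 1 ⟨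
      ∑[ x < k * order ] 1
        ≡⟨ sum-cong-≗ (λ x → 𝟙-not (Vec.lookup S x)) ⟩
      ∑[ x < k * order ] (𝟙 (Vec.lookup S x) + 𝟙 (not (Vec.lookup S x)))
        ≡⟨ ∑-distrib-+ (λ x → 𝟙 (Vec.lookup S x)) _ ⟩
      ∑[ x < k * order ] 𝟙 (Vec.lookup S x) + ∑[ x < k * order ] 𝟙 (not (Vec.lookup S x))
        ≡⟨ cong₂ _+_ (∑-lookup S) (∑-combine k order _) ⟩
      ∣ S ∣ + ∑[ i < k ] ∑[ u < order ] 𝟙 (not (Vec.lookup S (at i u)))
        ≤⟨ +-monoʳ-≤ ∣ S ∣ (∑-mono λ i → ∑-atMostOne _ (unique i)) ⟩
      ∣ S ∣ + ∑[ i < k ] 1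
        ≡⟨ cong (∣ S ∣ +_) (trans (∑-const k 1) (*-identityʳ k)) ⟩
      ∣ S ∣ + k ∎
      where
      open ≤-Reasoning
      𝟙-not : ∀ b → 1 ≡ 𝟙 b + 𝟙 (not b)
      𝟙-not true  = refl
      𝟙-not false = refl
      ∉S : ∀ {x} → T (not (Vec.lookup S x)) → x ∉ S
      ∉S t x∈S rewrite []=⇒lookup x∈S = t
      unique : ∀ i u v → T (not (Vec.lookup S (at i u))) → T (not (Vec.lookup S (at i v))) → u ≡ v
      unique i u v u∉ v∉ = Fin.combine-injectiveʳ i u i v
        (uncovered-unique chain ivc (∉S u∉) (∉S v∉) (close-chain i u v))

    -- The hypothesis is the budget of one copy, scaled by the denominator of `B-HY`: 2 for the link
    -- ends, `1 + Δ ^ 2` for the one vertex that may be missed, and 1 for the gain. Over all copies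
    -- the gains add up to `k`.
    τ-D-chain : ∀ Δ →
      Δ * (Δ ∸ 1) * order + (2 * size + 2) + 1 + (1 + Δ ^ 2) ≤ order * (1 + Δ ^ 2) →
      Δ * (Δ ∸ 1) * Graph.order chain + 2 * Graph.size chain + k ≤ τ-D chain * (1 + Δ ^ 2)
    -- Adding `k * D`, the cost of the missed vertices, to both sides makes the left side a multiple
    -- of `k`.
    τ-D-chain Δ heavy = +-cancelʳ-≤ (k * D) _ _ (begin
      a * (k * order) + 2 * Graph.size chain + k + k * D
        ≤⟨ +-monoˡ-≤ (k * D) (+-monoˡ-≤ k (+-monoʳ-≤ (a * (k * order)) size-chain)) ⟩
      a * (k * order) + k * (2 * size + 2) + k + k * D
        ≡⟨ factor k a order (2 * size + 2) D ⟩
      k * (a * order + (2 * size + 2) + 1 + D)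
        ≤⟨ *-monoʳ-≤ k heavy ⟩
      k * (order * D)
        ≡⟨ *-assoc k order D ⟨
      k * order * D
        ≤⟨ *-monoˡ-≤ D (order≤∣S∣+k (proj₁ (proj₂ (minimumIVC chain)))) ⟩
      (τ-D chain + k) * D
        ≡⟨ *-distribʳ-+ D (τ-D chain) k ⟩
      τ-D chain * D + k * D ∎)
      where
      open ≤-Reasoning
      a = Δ * (Δ ∸ 1)
      D = 1 + Δ ^ 2
      factor : ∀ k a n b D → a * (k * n) + k * b + k + k * D ≡ k * (a * n + b + 1 + D)
      factor = solve-∀

-- Here `d` is the maximum degree of `G` and `e` the largest number of link ends at one vertex. Both
-- are attained at `p`, so they add up.
maxDegree-chain : ∀ G (p q : Graph.Vertex G) k {d e} →
  (∀ u → Graph.degree G u ≤ d) → (∀ u → 𝟙 (does (p ≟ u)) + 𝟙 (does (q ≟ u)) ≤ e) →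
  Graph.degree G p ≡ d → 1 + 𝟙 (does (q ≟ p)) ≡ e →
  Graph.maxDegree (Chain.chain G p q (3 + k)) ≡ d + e
maxDegree-chain G p q k {d} {e} degree≤d ends≤e degree≡d ends≡e =
  -- Copy 1 has a predecessor and a successor, so all possible links are present there.
  maxDegree≡ chain
    (λ x → let (i , u) = remQuot {3 + k} order x in
      ≤-trans (≤-reflexive (degree-chain x)) (≤-trans (degree₂≤ i u) (+-mono-≤ (degree≤d u) (ends≤e u))))
    (at 1F p)
    (begin
      Graph.degree chain (at 1F p)
        ≡⟨ degree-chain (at 1F p) ⟩
      degree₂ (remQuot order (at 1F p))
        ≡⟨ cong degree₂ (remQuot-combine {3 + k} 1F p) ⟩
      degree p + (𝟙 (does (p ≟ p)) * succs 1F + 𝟙 (does (q ≟ p)) * preds 1F)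
        ≡⟨ cong₂ (λ a b → degree p + (a + b))
             (cong₂ _*_ (cong 𝟙 (dec-true (p ≟ p) refl)) (cong suc (sum-replicate-zero k)))
             (trans (cong (λ a → 𝟙 (does (q ≟ p)) * suc a) (sum-replicate-zero k))
               (*-identityʳ (𝟙 (does (q ≟ p))))) ⟩
      degree p + (1 + 𝟙 (does (q ≟ p)))
        ≡⟨ cong₂ _+_ degree≡d ends≡e ⟩
      d + e ∎)
  where
  open ≡-Reasoning
  open Graph G
  open Chain G p q (3 + k)

-- The Petersen graph and its blow-up.

-- The Petersen graph as a Kneser graph: vertices 0–5 are the pairs avoiding 4, vertices 6–9 the
-- independent set of pairs containing 4.
pairs : Vec.Vec (Fin 5 × Fin 5) 10
pairs = (0F , 1F) Vec.∷ (0F , 2F) Vec.∷ (0F , 3F) Vec.∷ (1F , 2F) Vec.∷ (1F , 3F) Vec.∷ (2F , 3F) Vec.∷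
        (0F , 4F) Vec.∷ (1F , 4F) Vec.∷ (2F , 4F) Vec.∷ (3F , 4F) Vec.∷ Vec.[]

petersen : Fin 10 → Fin 10 → Bool
petersen a b = disjoint (Vec.lookup pairs a) (Vec.lookup pairs b)
  where
  disjoint : Fin 5 × Fin 5 → Fin 5 × Fin 5 → Bool
  disjoint (a , b) (c , d) =
    not (does (a ≟ c)) ∧ not (does (a ≟ d)) ∧ not (does (b ≟ c)) ∧ not (does (b ≟ d))

petersen-sym : ∀ a b → petersen a b ≡ petersen b a
petersen-sym = from-yes (all? λ a → all? λ b → petersen a b Bool.≟ petersen b a)

petersen-irrefl : ∀ a → petersen a a ≡ false
petersen-irrefl = from-yes (all? λ a → petersen a a Bool.≟ false)

petersen-close : ∀ a b → T (petersen a b) ⊎ ∃ λ c → T (petersen c a) × T (petersen c b)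
petersen-close = from-yes (all? λ a → all? λ b →
  T? (petersen a b) ⊎-dec any? λ c → T? (petersen c a) ×-dec T? (petersen c b))

-- Each of the vertices 6–9 of the Petersen graph is replaced by s twins.
module Blowup (s : ℕ) where

  -- The projection onto the Petersen graph: among the twins the remainder modulo 4 gives the class
  -- and the quotient numbers the twin.
  class : Fin (6 + s * 4) → Fin 10
  class x = join 6 4 (Sum.map₂ (remainder {s} 4) (splitAt 6 x))

  blowup : Graph
  blowup = record
    { order      = 6 + s * 4
    ; adj        = λ x y → petersen (class x) (class y)
    ; adj-sym    = λ x y → petersen-sym (class x) (class y)
    ; adj-irrefl = λ x → petersen-irrefl (class x)
    }

  ∑-class : ∀ (f : Vector ℕ 10) →
    ∑[ x < 6 + s * 4 ] f (class x) ≡ ∑[ h < 6 ] f (h ↑ˡ 4) + s * ∑[ l < 4 ] f (6 ↑ʳ l)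
  ∑-class f = begin
    ∑[ x < 6 + s * 4 ] f (class x)
      ≡⟨ ∑-split 6 {s * 4} (λ x → f (class x)) ⟩
    ∑[ h < 6 ] f (class (h ↑ˡ s * 4)) + ∑[ y < s * 4 ] f (6 ↑ʳ remainder {s} 4 y)
      ≡⟨ cong₂ _+_
           (sum-cong-≗ λ h → cong (f ∘ join 6 4 ∘ Sum.map₂ (remainder {s} 4)) (Fin.splitAt-↑ˡ 6 h (s * 4)))
           (∑-remQuot s 4 (λ (_ , l) → f (6 ↑ʳ l))) ⟩
    ∑[ h < 6 ] f (h ↑ˡ 4) + ∑[ i < s ] ∑[ l < 4 ] f (6 ↑ʳ l)
      ≡⟨ cong (∑[ h < 6 ] f (h ↑ˡ 4) +_) (∑-const s _) ⟩
    ∑[ h < 6 ] f (h ↑ˡ 4) + s * ∑[ l < 4 ] f (6 ↑ʳ l) ∎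
    where open ≡-Reasoning

  valency : Fin 10 → ℕ
  valency a = ∑[ h < 6 ] 𝟙 (petersen a (h ↑ˡ 4)) + s * ∑[ l < 4 ] 𝟙 (petersen a (6 ↑ʳ l))

  degree-blowup : ∀ x → Graph.degree blowup x ≡ valency (class x)
  degree-blowup x = trans (degree≡∑ blowup x) (∑-class (λ b → 𝟙 (petersen (class x) b)))

  size-blowup : 2 * Graph.size blowup ≡ 6 * (1 + s * 2) + s * 12
  size-blowup = begin
    2 * Graph.size blowup
      ≡⟨ handshake blowup ⟩
    ∑[ x < 6 + s * 4 ] Graph.degree blowup x
      ≡⟨ sum-cong-≗ degree-blowup ⟩
    ∑[ x < 6 + s * 4 ] valency (class x)
      ≡⟨ ∑-class valency ⟩
    6 * (1 + s * 2) + s * (4 * (3 + s * 0))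
      -- The product `s * 0` comes from the absence of edges between the replaced vertices; it does
      -- not reduce for a variable `s`.
      ≡⟨ cong (λ z → 6 * (1 + s * 2) + s * (4 * (3 + z))) (*-zeroʳ s) ⟩
    6 * (1 + s * 2) + s * 12 ∎
    where open ≡-Reasoning

module _ (t : ℕ) where
  open Blowup (suc t)

  -- The possible degrees are `1 + s * 2` and 3, and the former is at least the latter because `s`
  -- is `suc t`.
  valency≤ : ∀ a → valency a ≤ 1 + suc t * 2
  valency≤ = bound ∘ table
    where
    -- These sums do not involve `t`, so checking the ten classes decides the statement.
    table : ∀ a → (∑[ h < 6 ] 𝟙 (petersen a (h ↑ˡ 4)) ≡ 1 × ∑[ l < 4 ] 𝟙 (petersen a (6 ↑ʳ l)) ≡ 2)
                ⊎ (∑[ h < 6 ] 𝟙 (petersen a (h ↑ˡ 4)) ≡ 3 × ∑[ l < 4 ] 𝟙 (petersen a (6 ↑ʳ l)) ≡ 0)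
    table = from-yes (all? λ a →
      (∑[ h < 6 ] 𝟙 (petersen a (h ↑ˡ 4)) ℕ.≟ 1 ×-dec ∑[ l < 4 ] 𝟙 (petersen a (6 ↑ʳ l)) ℕ.≟ 2) ⊎-dec
      (∑[ h < 6 ] 𝟙 (petersen a (h ↑ˡ 4)) ℕ.≟ 3 ×-dec ∑[ l < 4 ] 𝟙 (petersen a (6 ↑ʳ l)) ℕ.≟ 0))
    bound : ∀ {m n} → (m ≡ 1 × n ≡ 2) ⊎ (m ≡ 3 × n ≡ 0) → m + suc t * n ≤ 1 + suc t * 2
    bound (inj₁ (refl , refl)) = ≤-refl
    bound (inj₂ (refl , refl)) = s≤s (s≤s (s≤s (≤-trans (≤-reflexive (*-zeroʳ t)) z≤n)))

  -- Since there is at least one twin of each replaced vertex, the first one represents its class.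
  class-surjective : ∀ a → ∃ λ x → class x ≡ a
  class-surjective a = representative a , from-yes (all? λ a → class (representative a) ≟ a) a
    where
    representative : Fin 10 → Fin (6 + suc t * 4)
    representative a = join 6 (suc t * 4) (Sum.map₂ (_↑ˡ t * 4) (splitAt 6 a))

  -- Closeness lifts along `class`. Twins are covered too: a Petersen vertex is close to itself
  -- through any neighbour.
  blowup-close : ∀ x y → Close blowup x y
  blowup-close x y = Sum.map₂ lift (petersen-close (class x) (class y))
    where
    lift : (∃ λ c → T (petersen c (class x)) × T (petersen c (class y))) →
           ∃ λ w → T (petersen (class w) (class x)) × T (petersen (class w) (class y))
    lift (c , c~x , c~y) =
      let (w , eq) = class-surjective c in
      w , subst (λ a → T (petersen a (class x))) (sym eq) c~x
        , subst (λ a → T (petersen a (class y))) (sym eq) c~y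

-- From natural number inequalities to rational ones.

-- Opened only here because +_ makes the sections x +_ above ambiguous.
open import Data.Integer.Base using (+_)
open import Data.Rational.Base using (_/_)

+-/1-numerator : ∀ c x d → + (x + d * c) ≡ (+ c ℤ.* + d ℤ.+ + x ℤ.* + 1) ℤ.* + 1
+-/1-numerator c x d = begin
  + (x + d * c)                          ≡⟨ cong (λ n → + n) (swap c x d) ⟩
  + (c * d + x * 1)                      ≡⟨ ℤ.pos-+ (c * d) (x * 1) ⟩
  + (c * d) ℤ.+ + (x * 1)                ≡⟨ cong₂ ℤ._+_ (ℤ.pos-* c d) (ℤ.pos-* x 1) ⟩
  + c ℤ.* + d ℤ.+ + x ℤ.* + 1            ≡⟨ ℤ.*-identityʳ (+ c ℤ.* + d ℤ.+ + x ℤ.* + 1) ⟨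
  (+ c ℤ.* + d ℤ.+ + x ℤ.* + 1) ℤ.* + 1  ∎
  where
  open ≡-Reasoning
  swap : ∀ c x d → x + d * c ≡ c * d + x * 1
  swap = solve-∀

-- The hypothesis is the inequality after cross-multiplication; unnormalised rationals keep
-- numerators and denominators explicit.
/1+/≤/1 : ∀ c x d t → x + suc d * c ≤ t * suc d → + c / 1 ℚ.+ + x / suc d ℚ.≤ + t / 1
/1+/≤/1 c x d t x+dc≤td = ℚ.toℚᵘ-cancel-≤ (begin
  ℚ.toℚᵘ (+ c / 1 ℚ.+ + x / suc d)
    ≃⟨ ℚ.toℚᵘ-homo-+ (+ c / 1) (+ x / suc d) ⟩
  ℚ.toℚᵘ (+ c / 1) ℚᵘ.+ ℚ.toℚᵘ (+ x / suc d)
    ≃⟨ ℚᵘ.+-cong (ℚ.toℚᵘ-fromℚᵘ (mkℚᵘ (+ c) 0)) (ℚ.toℚᵘ-fromℚᵘ (mkℚᵘ (+ x) d)) ⟩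
  mkℚᵘ (+ c) 0 ℚᵘ.+ mkℚᵘ (+ x) d
    ≤⟨ *≤* (subst₂ ℤ._≤_ (+-/1-numerator c x (suc d)) t*d≡ (ℤ.+≤+ x+dc≤td)) ⟩
  mkℚᵘ (+ t) 0
    ≃⟨ ℚ.toℚᵘ-fromℚᵘ (mkℚᵘ (+ t) 0) ⟨
  ℚ.toℚᵘ (+ t / 1) ∎)
  where
  open ℚᵘ.≤-Reasoning
  t*d≡ : + (t * suc d) ≡ + t ℤ.* + (1 * suc d)
  t*d≡ = trans (cong (λ d → + (t * d)) (sym (*-identityˡ (suc d)))) (ℤ.pos-* t (1 * suc d))

-- The absolute value of the numerator, increased by one, exceeds `q` because the denominator is at
-- least 1.
∃-/1-above : ∀ q → ∃ λ c → q ℚ.< + c / 1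
∃-/1-above q@(ℚ.mkℚ n d _) = c , ℚ.toℚᵘ-cancel-<
  (ℚᵘ.<-respʳ-≃ (ℚᵘ.≃-sym (ℚ.toℚᵘ-fromℚᵘ (mkℚᵘ (+ c) 0)))
    (*<* (ℤ.≤-<-trans (ℤ.≤-reflexive (ℤ.*-identityʳ n))
      (subst (n ℤ.<_) (ℤ.pos-* c (suc d)) (ℤ.≤-<-trans (i≤+∣i∣ n) (ℤ.+<+ (m≤m*n c (suc d))))))))
  where
  c = suc ℤ.∣ n ∣
  i≤+∣i∣ : ∀ i → i ℤ.≤ + ℤ.∣ i ∣
  i≤+∣i∣ (+ n)        = ℤ.≤-refl
  i≤+∣i∣ (ℤ.-[1+ n ]) = ℤ.-≤+

gap : ∀ G c {Δ} → Graph.maxDegree G ≡ Δ →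
  Δ * (Δ ∸ 1) * Graph.order G + 2 * Graph.size G + (1 + Δ ^ 2) * c ≤ τ-D G * (1 + Δ ^ 2) →
  + c / 1 ℚ.≤ + τ-D G / 1 ℚ.- B-HY G
gap G c refl bound = begin
  + c / 1                               ≡⟨ ℚ.+-identityʳ (+ c / 1) ⟨
  + c / 1 ℚ.+ ℚ.0ℚ                      ≡⟨ cong (+ c / 1 ℚ.+_) (ℚ.+-inverseʳ (B-HY G)) ⟨
  + c / 1 ℚ.+ (B-HY G ℚ.- B-HY G)       ≡⟨ ℚ.+-assoc (+ c / 1) (B-HY G) (ℚ.- B-HY G) ⟨
  (+ c / 1 ℚ.+ B-HY G) ℚ.- B-HY G       ≤⟨ ℚ.+-monoˡ-≤ (ℚ.- B-HY G) (/1+/≤/1 c X (Δ ^ 2) (τ-D G) bound) ⟩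
  + τ-D G / 1 ℚ.- B-HY G                ∎
  where
  open ℚ.≤-Reasoning
  Δ = Graph.maxDegree G
  X = Δ * (Δ ∸ 1) * Graph.order G + 2 * Graph.size G

-- Unboundedness of the supremum.

Below-A : ∀ G c {Δ r} → Graph.Connected G → Graph.maxDegree G ≡ Δ →
  Δ * (Δ ∸ 1) * Graph.order G + 2 * Graph.size G + (1 + Δ ^ 2) * c ≤ τ-D G * (1 + Δ ^ 2) →
  r ℚ.< + c / 1 → Below (A Δ) r
Below-A G c connected maxDegree≡Δ bound r<c =
  (G , connected , maxDegree≡Δ) , ℚ.<-≤-trans r<c (gap G c maxDegree≡Δ bound)

A-unbounded : ∀ G (p q : Graph.Vertex G) {d e} →
  (∀ u v → Close G u v) →
  (∀ u → Graph.degree G u ≤ d) → (∀ u → 𝟙 (does (p ≟ u)) + 𝟙 (does (q ≟ u)) ≤ e) →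
  Graph.degree G p ≡ d → 1 + 𝟙 (does (q ≟ p)) ≡ e →
  (d + e) * (d + e ∸ 1) * Graph.order G + (2 * Graph.size G + 2) + 1 + (1 + (d + e) ^ 2)
    ≤ Graph.order G * (1 + (d + e) ^ 2) →
  +∞ ≤ᴿ A (d + e)
A-unbounded G p q {d} {e} close degree≤d ends≤e degree≡d ends≡e heavy r _ =
  let (c , r<c) = ∃-/1-above r
      -- A gain of 1 per copy in the scaled inequality yields `c` after division by
      -- `1 + (d + e) ^ 2`.
      k         = (1 + (d + e) ^ 2) * c
      chain     = Chain.chain G p q (3 + k)
  in Below-A chain c
       (Chain.chain-connected G p q (3 + k) close)
       (maxDegree-chain G p q k degree≤d ends≤e degree≡d ends≡e)
       -- The three further copies, present to provide an interior copy, only increase the gain.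
       (≤-trans (+-monoʳ-≤ ((d + e) * (d + e ∸ 1) * Graph.order chain + 2 * Graph.size chain) (m≤n+m k 3))
         (Chain.τ-D-chain G p q (3 + k) close (d + e) heavy))
       r<c

module PetersenChain (t : ℕ) where
  open Blowup (suc t)

  private
    d  = 1 + suc t * 2
    n₀ = 6 + suc t * 4

  unbounded : ∀ q {e} →
    (∀ u → 𝟙 (does (zero ≟ u)) + 𝟙 (does (q ≟ u)) ≤ e) → 1 + 𝟙 (does (q ≟ zero)) ≡ e →
    (d + e) * (d + e ∸ 1) * n₀ + (6 * d + suc t * 12 + 2) + 1 + (1 + (d + e) ^ 2) ≤ n₀ * (1 + (d + e) ^ 2) →
    +∞ ≤ᴿ A (d + e)
  unbounded q {e} ends≤e ends≡e heavy = A-unbounded blowup zero q (blowup-close t)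
    (λ u → ≤-trans (≤-reflexive (degree-blowup u)) (valency≤ t (class u))) ends≤e (degree-blowup zero) ends≡e
    (subst (λ m → (d + e) * (d + e ∸ 1) * n₀ + (m + 2) + 1 + (1 + (d + e) ^ 2) ≤ n₀ * (1 + (d + e) ^ 2))
      (sym size-blowup) heavy)

-- The numerical condition and the two parities of Δ.

heavy-1 : ∀ t → let d = 1 + suc t * 2; n = 6 + suc t * 4 in
  (d + 1) * (d + 1 ∸ 1) * n + (6 * d + suc t * 12 + 2) + 1 + (1 + (d + 1) ^ 2) ≤ n * (1 + (d + 1) ^ 2)
heavy-1 t = m+n≤o⇒m≤o _ (≤-reflexive (slack t))
  where
  -- With `∸` and `^` unfolded the claim is a polynomial identity. The surplus is `4 * (t * t)`, so
  -- equality holds for Δ = 4.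
  slack : ∀ t → let d = 1 + suc t * 2; n = 6 + suc t * 4 in
    (d + 1) * (suc t * 2 + 1) * n + (6 * d + suc t * 12 + 2) + 1 + (1 + (d + 1) * ((d + 1) * 1)) + 4 * (t * t) ≡
    n * (1 + (d + 1) * ((d + 1) * 1))
  slack = solve-∀

heavy-2 : ∀ t → let d = 1 + suc t * 2; n = 6 + suc t * 4 in
  (d + 2) * (d + 2 ∸ 1) * n + (6 * d + suc t * 12 + 2) + 1 + (1 + (d + 2) ^ 2) ≤ n * (1 + (d + 2) ^ 2)
heavy-2 t = m+n≤o⇒m≤o _ (≤-reflexive (slack t))
  where
  slack : ∀ t → let d = 1 + suc t * 2; n = 6 + suc t * 4 in
    (d + 2) * (suc t * 2 + 2) * n + (6 * d + suc t * 12 + 2) + 1 + (1 + (d + 2) * ((d + 2) * 1)) + (4 * (t * t) + 1) ≡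
    n * (1 + (d + 2) * ((d + 2) * 1))
  slack = solve-∀

ends-1 : ∀ {n} (u : Fin (2 + n)) → 𝟙 (does (zero ≟ u)) + 𝟙 (does (1F ≟ u)) ≤ 1
ends-1 zero          = ≤-refl
ends-1 (suc zero)    = ≤-refl
ends-1 (suc (suc _)) = z≤n

ends-2 : ∀ {n} (u : Fin (suc n)) → 𝟙 (does (zero ≟ u)) + 𝟙 (does (zero ≟ u)) ≤ 2
ends-2 zero    = ≤-refl
ends-2 (suc _) = z≤n

parity : ∀ m → ∃ λ t → m ≡ t * 2 ⊎ m ≡ suc (t * 2)
parity zero    = 0 , inj₁ refl
parity (suc m) with parity m
... | t , inj₁ refl = t , inj₂ refl
... | t , inj₂ refl = suc t , inj₁ refl

-- The ends of the links in the blown-up Petersen graph are chosen so that they raise the degree of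
-- vertex 0 by exactly what is missing to Δ: distinct ends raise it by 1, equal ends by 2.
A-infinite : ∀ {Δ} m → 4 + m ≡ Δ → (∃ λ t → m ≡ t * 2 ⊎ m ≡ suc (t * 2)) → +∞ ≤ᴿ A Δ
A-infinite {Δ} m 4+m≡Δ (t , inj₁ eq) =
  subst (λ Δ → +∞ ≤ᴿ A Δ) Δ≡ (PetersenChain.unbounded t 1F ends-1 refl (heavy-1 t))
  where
  Δ≡ : 1 + suc t * 2 + 1 ≡ Δ
  Δ≡ = trans (+-comm (1 + suc t * 2) 1) (trans (cong (λ m → 4 + m) (sym eq)) 4+m≡Δ)
A-infinite {Δ} m 4+m≡Δ (t , inj₂ eq) =
  subst (λ Δ → +∞ ≤ᴿ A Δ) Δ≡ (PetersenChain.unbounded t 0F ends-2 refl (heavy-2 t))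
  where
  Δ≡ : 1 + suc t * 2 + 2 ≡ Δ
  Δ≡ = trans (+-comm (1 + suc t * 2) 2) (trans (cong (λ m → 4 + m) (sym eq)) 4+m≡Δ)

theorem4p6 : ∀ (Δ : ℕ) → 4 ≤ Δ → A Δ ≈ᴿ +∞
-- The upper bound is immediate, as the cut of `+∞` contains every rational.
theorem4p6 Δ 4≤Δ = (λ _ _ → _) , A-infinite (Δ ∸ 4) (m+[n∸m]≡n 4≤Δ) (parity (Δ ∸ 4))
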